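{- For even $n\ge 4$, let $\mathcal{G}$ be the simple temporal graph on $3n$ vertices defined in the context, and let $\mathcal{G}'$ be the temporal graph obtained from $\mathcal{G}$ by increasing the time label of the edge $\{a_1,m_1\}$ from $\epsilon$ to $1$. Then $\mathcal{G}'$ admits a temporal connectivity certificate with $\Theta(n)$ edges.
   Context: A simple temporal graph is an undirected graph in which each edge carries a single time label (real labels are used for convenience; only their relative order matters). A temporal path from $u$ to $v$ is a path from $u$ to $v$ whose successive edges have non-decreasing time labels. A temporal graph is (temporally) connected if there is a temporal path from $u$ to $v$ for every ordered pair $(u,v)$ of vertices. A temporal connectivity certificate of a temporal graph is a spanning subgraph (same vertices, a subset of the labelled edges) that is also temporally connected. Construction of $\mathcal{G}$, for even $n$. The vertex set is partitioned into $A=\{a_1,\dots,a_n\}$, $H=\{h_1,\dots,h_n\}$, $M=\{m_1,\dots,m_n\}$. Fix $\epsilon\in(0,1/(4n))$. (1) The underlying graph on $A$ is the complete graph $K_n$; its edges are partitioned into $n/2$ edge-disjoint Hamiltonian paths $p_1,\dots,p_{n/2}$ of $K_n$, and all edges of $p_i$ have time label $i$. (2) There are no edges inside $H$. For every $i\in\{1,\dots,n/2\}$, one endpoint of $p_i$ is joined to $h_{2i-1}$ and the other endpoint of $p_i$ is joined to $h_{2i}$; both edges have time label $i$. (3) For every $i\in\{1,\dots,n/2\}$: $m_{2i-1}$ is joined to $h_{2i-1}$ with label $n/2+2i-1$ and to $h_{2i}$ with label $n/2+2i$; $m_{2i}$ is joined to $h_{2i-1}$ with label $(n/2+2i-1)\epsilon$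 and to $h_{2i}$ with label $(n/2+2i)\epsilon$. (4) Inside $M$: for every $i\in\{1,\dots,n/2-2\}$ there are edges $\{m_{2i-1},m_{2i+2}\}$ and $\{m_{2i-1},m_n\}$, and there is one further edge $\{m_{n-3},m_n\}$. Order these edges in decreasing order of their endpoint of higher index, breaking ties in increasing order of their endpoint of lower index, i.e. $\{m_1,m_n\},\{m_3,m_n\},\dots,\{m_{n-3},m_n\},\{m_{n-5},m_{n-2}\},\{m_{n-7},m_{n-4}\},\dots,\{m_1,m_4\}$. The $k$-th edge in this order has time label $1-(k-1)\epsilon$. (5) For every $i\in\{1,\dots,n/2\}$ there is an edge $\{m_{2i-1},a_{2i-1}\}$ with label $\epsilon$ and an edge $\{m_{2i},a_{2i}\}$ with label $n+1$.
   Formalization: The time labels and the parameter ε in (0, 1/(4n)) are rational numbers instead of real numbers. -}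

module Defs where

open import Data.Fin.Base using (Fin; zero; suc; toℕ; fromℕ<)
open import Data.Fin.Permutation using (Permutation′; _⟨$⟩ʳ_; _⟨$⟩ˡ_; inverseˡ)
open import Data.Fin.Properties using (toℕ-fromℕ<; toℕ-injective)
import Data.Integer.Base as ℤ
open import Data.List.Base using (List; []; _∷_; _++_; length; lookup; applyUpTo; applyDownFrom)
open import Data.List.Relation.Unary.All as All using (All; []; _∷_)
import Data.List.Relation.Unary.All.Properties as All
open import Data.List.Relation.Unary.AllPairs using (AllPairs; []; _∷_)
import Data.List.Relation.Unary.AllPairs.Properties as AllPairs
open import Data.List.Relation.Unary.Any using (Any)
open import Data.List.Relation.Unary.Linked using (Linked)
open import Data.List.Relation.Unary.Unique.Propositional using (Unique)
import Data.List.Relation.Unary.Unique.Propositional.Properties as Unique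
open import Data.List.Membership.Propositional.Properties using (∈-lookup)
open import Data.Nat.Base hiding (_/_)
open import Data.Nat.Divisibility using (_∣_; quotient)
open import Data.Nat.Properties
open import Data.Product.Base using (Σ-syntax; ∃-syntax; _×_; _,_; proj₁; proj₂; uncurry)
open import Data.Rational.Base as ℚ using (ℚ; 0ℚ; 1ℚ)
open import Data.Sum.Base using (_⊎_; inj₁; inj₂; swap; [_,_])
open import Function.Base using (_∘_)
open import Relation.Binary.PropositionalEquality hiding ([_])
open import Relation.Nullary.Negation using (¬_; contradiction)

toℚ : ℕ → ℚ
toℚ k = ℤ.+ k ℚ./ 1

SamePair : {V : Set} → V × V → V × V → Set
SamePair (u , v) (x , y) = (u ≡ x × v ≡ y) ⊎ (u ≡ y × v ≡ x)

------------------------------------------------------------------------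
-- Temporal graphs

-- Edge u v t: there is an edge {u , v}, and its time label is t.  Only the
-- relative order of labels matters, so rational labels stand in for real ones.

record SimpleTemporalGraph (V : Set) : Set₁ where
  field
    Edge      : V → V → ℚ → Set
    symmetric : ∀ {u v t} → Edge u v t → Edge v u t
    loopless  : ∀ {v t} → ¬ Edge v v t
    single    : ∀ {u v s t} → Edge u v s → Edge u v t → s ≡ t

open SimpleTemporalGraph

module _ {V : Set} where

  data Walk (G : SimpleTemporalGraph V) : V → V → Set where
    []  : ∀ {v} → Walk G v v
    _∷_ : ∀ {u w v t} → Edge G u w t → Walk G w v → Walk G u v

  vertices : ∀ {G u v} → Walk G u v → List V
  vertices {u = u} []      = u ∷ []
  vertices {u = u} (_ ∷ p) = u ∷ vertices p

  labels : ∀ {G u v} → Walk G u v → List ℚ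
  labels []                = []
  labels (_∷_ {t = t} _ p) = t ∷ labels p

  TemporalPath : SimpleTemporalGraph V → V → V → Set
  TemporalPath G u v =
    Σ[ p ∈ Walk G u v ] Unique (vertices p) × Linked ℚ._≤_ (labels p)

  TemporallyConnected : SimpleTemporalGraph V → Set
  TemporallyConnected G = ∀ u v → TemporalPath G u v

  _⊆_ : SimpleTemporalGraph V → SimpleTemporalGraph V → Set
  H ⊆ G = ∀ {u v t} → Edge H u v t → Edge G u v t

  ConnectivityCertificate : (G H : SimpleTemporalGraph V) → Set
  ConnectivityCertificate G H = H ⊆ G × TemporallyConnected H

  -- H has exactly e edges: the edges are listed once each, as unordered pairs.
  record EdgeCount (H : SimpleTemporalGraph V) (e : ℕ) : Set where
    field
      edges    : List (V × V)
      sound    : All (λ (u , v) → ∃[ t ] Edge H u v t) edges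
      complete : ∀ {u v t} → Edge H u v t → Any (SamePair (u , v)) edges
      distinct : AllPairs (λ e f → ¬ SamePair e f) edges
      count    : length edges ≡ e

  -- The graph G with the label of its edge {u , v} replaced by t.
  relabel : (G : SimpleTemporalGraph V) {u v : V} {s : ℚ} →
            Edge G u v s → ℚ → SimpleTemporalGraph V
  relabel G {u} {v} uv t = record
    { Edge      = Edge′
    ; symmetric = λ where
        (inj₁ (same , eq))  → inj₁ (flip same , eq)
        (inj₂ (other , xy)) → inj₂ (other ∘ flip , symmetric G xy)
    ; loopless  = λ where
        (inj₁ (inj₁ (refl , refl) , _)) → loopless G uv
        (inj₁ (inj₂ (refl , refl) , _)) → loopless G uv
        (inj₂ (_ , xx))                 → loopless G xx
    ; single    = λ where
        (inj₁ (_ , refl))   (inj₁ (_ , refl))   → refl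
        (inj₁ (same , _))   (inj₂ (other , _))  → contradiction same other
        (inj₂ (other , _))  (inj₁ (same , _))   → contradiction same other
        (inj₂ (_ , xy))     (inj₂ (_ , xy′))    → single G xy xy′
    }
    where
    Edge′ : V → V → ℚ → Set
    Edge′ x y r = (SamePair (x , y) (u , v) × r ≡ t)
                ⊎ (¬ SamePair (x , y) (u , v) × Edge G x y r)

    flip : ∀ {x y} → SamePair (x , y) (u , v) → SamePair (y , x) (u , v)
    flip (inj₁ (p , q)) = inj₂ (q , p)
    flip (inj₂ (p , q)) = inj₁ (q , p)

------------------------------------------------------------------------
-- Hamiltonian path decompositions of Kₙ

-- Converts the elements of Fin n to the indices 1 , … , n.
index : ∀ {n} → Fin n → ℕ
index x = suc (toℕ x)

-- A Hamiltonian path of Kₙ is given by the order in which it visits the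
-- vertices; Step holds of both orientations of each of its edges.

Step : ∀ {n} → Permutation′ n → Fin n → Fin n → Set
Step {n} p x y = Σ[ j ∈ Fin n ] Σ[ k ∈ Fin n ]
  index k ≡ suc (index j) × SamePair (x , y) (p ⟨$⟩ʳ j , p ⟨$⟩ʳ k)

Starts Ends : ∀ {n} → Permutation′ n → Fin n → Set
Starts {n} p x = Σ[ j ∈ Fin n ] index j ≡ 1 × p ⟨$⟩ʳ j ≡ x
Ends   {n} p x = Σ[ j ∈ Fin n ] index j ≡ n × p ⟨$⟩ʳ j ≡ x

record HamiltonianDecomposition (n k : ℕ) : Set where
  field
    path     : Fin k → Permutation′ n
    covering : ∀ {x y} → x ≢ y → ∃[ i ] Step (path i) x y
    disjoint : ∀ {i j x y} → Step (path i) x y → Step (path j) x y → i ≡ j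

------------------------------------------------------------------------
-- The construction

data Vertex (n : ℕ) : Set where
  a h m : Fin n → Vertex n

-- The index pairs of the edges inside M, lower endpoint first, in the order
-- that determines their labels:
--   (1 , n) , (3 , n) , … , (n - 5 , n) , (n - 3 , n) ,
--   (n - 5 , n - 2) , (n - 7 , n - 4) , … , (1 , 4).
mPairs : (n half : ℕ) → List (ℕ × ℕ)
mPairs n half =
     applyUpTo (λ j → let i = suc j in (2 * i ∸ 1 , n)) (half ∸ 2)
  ++ (n ∸ 3 , n)
   ∷ applyDownFrom (λ j → let i = suc j in (2 * i ∸ 1 , 2 * i + 2)) (half ∸ 2)

-- The free choices in the construction. Which endpoint of the i-th path is
-- joined to h₂ᵢ₋₁ and which to h₂ᵢ is also a free choice, made by the
-- orientation of the path: h₂ᵢ₋₁ is attached to its start.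
record Choices (n : ℕ) (even : 2 ∣ n) (4≤n : 4 ≤ n) : Set where
  instance
    4n≢0 : NonZero (4 * n)
    4n≢0 = >-nonZero (≤-trans (<-≤-trans z<s 4≤n) (m≤n*m n 4))
  field
    ε             : ℚ
    0<ε           : 0ℚ ℚ.< ε
    ε<1/4n        : ε ℚ.< ℤ.+ 1 ℚ./ (4 * n)
    decomposition : HamiltonianDecomposition n (quotient even)
  open HamiltonianDecomposition decomposition public

module Construction {n : ℕ} {even : 2 ∣ n} {4≤n : 4 ≤ n}
                    (choices : Choices n even 4≤n) where
  open Choices choices

  half : ℕ
  half = quotient even

  -- Each edge in one direction, except that edges inside A occur in both.
  data Arc : Vertex n → Vertex n → ℚ → Set where

    a-a : ∀ i {x y} → Step (path i) x y →
          Arc (a x) (a y) (toℚ (index i))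

    a-h₁ : ∀ (i : Fin half) {x y} → Starts (path i) x →
           index y ≡ 2 * index i ∸ 1 →
           Arc (a x) (h y) (toℚ (index i))
    a-h₂ : ∀ (i : Fin half) {x y} → Ends (path i) x →
           index y ≡ 2 * index i →
           Arc (a x) (h y) (toℚ (index i))

    m-h₁₁ : ∀ (i : Fin half) {x y} →
            index x ≡ 2 * index i ∸ 1 → index y ≡ 2 * index i ∸ 1 →
            Arc (m x) (h y) (toℚ (half + 2 * index i ∸ 1))
    m-h₁₂ : ∀ (i : Fin half) {x y} →
            index x ≡ 2 * index i ∸ 1 → index y ≡ 2 * index i →
            Arc (m x) (h y) (toℚ (half + 2 * index i))
    m-h₂₁ : ∀ (i : Fin half) {x y} →
            index x ≡ 2 * index i → index y ≡ 2 * index i ∸ 1 →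
            Arc (m x) (h y) (toℚ (half + 2 * index i ∸ 1) ℚ.* ε)
    m-h₂₂ : ∀ (i : Fin half) {x y} →
            index x ≡ 2 * index i → index y ≡ 2 * index i →
            Arc (m x) (h y) (toℚ (half + 2 * index i) ℚ.* ε)

    m-m : ∀ (k : Fin (length (mPairs n half))) {x y} →
          (index x , index y) ≡ lookup (mPairs n half) k →
          Arc (m x) (m y) (1ℚ ℚ.- toℚ (index k ∸ 1) ℚ.* ε)

    m-a₁ : ∀ (i : Fin half) {x y} →
           index x ≡ 2 * index i ∸ 1 → index y ≡ 2 * index i ∸ 1 →
           Arc (m x) (a y) ε
    m-a₂ : ∀ (i : Fin half) {x y} →
           index x ≡ 2 * index i → index y ≡ 2 * index i →
           Arc (m x) (a y) (toℚ (n + 1))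

  odd≢even : ∀ {x} k l → x ≡ 2 * suc k ∸ 1 → x ≢ 2 * suc l
  odd≢even k l p q =
    even≢odd (suc l) k (trans (trans (sym q) p) (+-suc k (k + 0)))

  odd-inj : ∀ {x} {i j : Fin half} →
            x ≡ 2 * index i ∸ 1 → x ≡ 2 * index j ∸ 1 → i ≡ j
  odd-inj {i = i} {j} p q = toℕ-injective (*-cancelˡ-≡ _ _ 2
    (suc-injective (trans (sym (+-suc _ _)) (trans (trans (sym p) q) (+-suc _ _)))))

  even-inj : ∀ {x} {i j : Fin half} →
             x ≡ 2 * index i → x ≡ 2 * index j → i ≡ j
  even-inj p q =
    toℕ-injective (suc-injective (*-cancelˡ-≡ _ _ 2 (trans (sym p) q)))

  n≡2half : n ≡ 2 * half
  n≡2half = trans (_∣_.equality even) (*-comm half 2)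

  odd< : ∀ {j k} → j < k → 2 * suc j ∸ 1 < 2 * suc k ∸ 1
  odd< {j} {k} j<k = subst₂ _<_ (sym (+-suc j _)) (sym (+-suc k _))
    (s<s (*-monoʳ-< 2 j<k))

  n-shape : Σ[ r ∈ ℕ ] half ∸ 2 ≡ r × n ≡ 3 + (2 * suc r ∸ 1)
  n-shape = go half n≡2half
    where
    go : ∀ q → n ≡ 2 * q → Σ[ r ∈ ℕ ] q ∸ 2 ≡ r × n ≡ 3 + (2 * suc r ∸ 1)
    go 0             eq = contradiction (subst (4 ≤_) eq 4≤n) λ ()
    go 1             eq = contradiction (subst (4 ≤_) eq 4≤n) λ where (s≤s (s≤s ()))
    go (suc (suc r)) eq = r , refl , trans eq (begin
      2 * (2 + r)           ≡⟨ *-distribˡ-+ 2 2 r ⟩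
      4 + 2 * r             ≡⟨ cong (3 +_) (+-suc r (r + 0)) ⟨
      3 + (2 * suc r ∸ 1)   ∎)
      where open ≡-Reasoning

  mPairs-unique×ordered : ∀ r n → n ≡ 3 + (2 * suc r ∸ 1) → ∀ q → q ∸ 2 ≡ r →
    Unique (mPairs n q) × All (uncurry _<_) (mPairs n q)
  mPairs-unique×ordered r n refl q refl =
      AllPairs.++⁺
        (Unique.applyUpTo⁺₁ _ r (λ i<j _ eq → <⇒≢ (odd< i<j) (cong proj₁ eq)))
        (All.applyDownFrom⁺₁ _ r (λ j<r eq → <⇒≢ (high j<r) (sym (cong proj₂ eq)))
          ∷ Unique.applyDownFrom⁺₁ _ r
              (λ j<i _ eq → <⇒≢ (odd< j<i) (sym (cong proj₁ eq))))
        (All.applyUpTo⁺₁ _ r λ i<r →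
          (λ eq → <⇒≢ (odd< i<r) (cong proj₁ eq))
          ∷ All.applyDownFrom⁺₁ _ r (λ j<r eq → <⇒≢ (high j<r) (sym (cong proj₂ eq))))
    , All.++⁺
        (All.applyUpTo⁺₁ _ r (λ i<r → <-trans (odd< i<r) (m<n+m _ {3} z<s)))
        (m<n+m _ {3} z<s ∷ All.applyDownFrom⁺₁ _ r (λ {j} _ →
          ≤-<-trans (m∸n≤m (2 * suc j) 1) (m<m+n _ z<s)))
    where
    high : ∀ {j} → j < r → 2 * suc j + 2 < 3 + (2 * suc r ∸ 1)
    high {j} j<r = subst₂ _<_ (+-comm 2 _)
      (cong (3 +_) (sym (+-suc r (r + 0))))
      (s<s (s<s (≤-<-trans (*-monoʳ-≤ 2 j<r) (<-trans (n<1+n _) (n<1+n _)))))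

  mPairs-unique : Unique (mPairs n half)
  mPairs-unique = let r , p , q = n-shape in proj₁ (mPairs-unique×ordered r n q half p)

  mPairs-ordered : ∀ k → uncurry _<_ (lookup (mPairs n half) k)
  mPairs-ordered k = let r , p , q = n-shape in
    All.lookup (proj₂ (mPairs-unique×ordered r n q half p)) (∈-lookup k)

  lookup-inj : ∀ {A : Set} {xs : List A} → Unique xs →
               ∀ i j → lookup xs i ≡ lookup xs j → i ≡ j
  lookup-inj (_ ∷ _)   zero    zero    _  = refl
  lookup-inj (x≢ ∷ _)  zero    (suc j) eq = contradiction eq (All.lookup x≢ (∈-lookup j))
  lookup-inj (x≢ ∷ _)  (suc i) zero    eq = contradiction (sym eq) (All.lookup x≢ (∈-lookup i))
  lookup-inj (_ ∷ xs!) (suc i) (suc j) eq = cong suc (lookup-inj xs! i j eq)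

  Step-sym : ∀ {p : Permutation′ n} {x y} → Step p x y → Step p y x
  Step-sym (j , k , eq , inj₁ (p , q)) = j , k , eq , inj₂ (q , p)
  Step-sym (j , k , eq , inj₂ (p , q)) = j , k , eq , inj₁ (q , p)

  Step-irrefl : ∀ (p : Permutation′ n) {x} → ¬ Step p x x
  Step-irrefl p (j , k , eq , inj₁ (u , v)) = 1+n≢n (trans (sym eq) (cong index k≡j))
    where k≡j = trans (sym (inverseˡ p)) (trans (cong (p ⟨$⟩ˡ_) (trans (sym v) u)) (inverseˡ p))
  Step-irrefl p (j , k , eq , inj₂ (u , v)) = 1+n≢n (trans (sym eq) (cong index k≡j))
    where k≡j = trans (sym (inverseˡ p)) (trans (cong (p ⟨$⟩ˡ_) (trans (sym u) v)) (inverseˡ p))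

  arc-loopless : ∀ {v t} → ¬ Arc v v t
  arc-loopless (a-a i s)  = Step-irrefl (path i) s
  arc-loopless (m-m k eq) = <-irrefl refl (subst (uncurry _<_) (sym eq) (mPairs-ordered k))

  arc-single : ∀ {u v s t} → Arc u v s → Arc u v t → s ≡ t
  arc-single (a-a i s)       (a-a j s′)       = cong (toℚ ∘ index) (disjoint s s′)
  arc-single (a-h₁ i _ p)    (a-h₁ j _ q)     = cong (toℚ ∘ index) (odd-inj p q)
  arc-single (a-h₁ i _ p)    (a-h₂ j _ q)     = contradiction q (odd≢even _ _ p)
  arc-single (a-h₂ i _ p)    (a-h₁ j _ q)     = contradiction p (odd≢even _ _ q)
  arc-single (a-h₂ i _ p)    (a-h₂ j _ q)     = cong (toℚ ∘ index) (even-inj p q)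
  arc-single (m-h₁₁ i p _)   (m-h₁₁ j q _)    = cong (λ i → toℚ (half + 2 * index i ∸ 1)) (odd-inj p q)
  arc-single (m-h₁₁ i _ p)   (m-h₁₂ j _ q)    = contradiction q (odd≢even _ _ p)
  arc-single (m-h₁₁ i p _)   (m-h₂₁ j q _)    = contradiction q (odd≢even _ _ p)
  arc-single (m-h₁₁ i p _)   (m-h₂₂ j q _)    = contradiction q (odd≢even _ _ p)
  arc-single (m-h₁₂ i _ p)   (m-h₁₁ j _ q)    = contradiction p (odd≢even _ _ q)
  arc-single (m-h₁₂ i p _)   (m-h₁₂ j q _)    = cong (λ i → toℚ (half + 2 * index i)) (odd-inj p q)
  arc-single (m-h₁₂ i p _)   (m-h₂₁ j q _)    = contradiction q (odd≢even _ _ p)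
  arc-single (m-h₁₂ i p _)   (m-h₂₂ j q _)    = contradiction q (odd≢even _ _ p)
  arc-single (m-h₂₁ i p _)   (m-h₁₁ j q _)    = contradiction p (odd≢even _ _ q)
  arc-single (m-h₂₁ i p _)   (m-h₁₂ j q _)    = contradiction p (odd≢even _ _ q)
  arc-single (m-h₂₁ i p _)   (m-h₂₁ j q _)    = cong (λ i → toℚ (half + 2 * index i ∸ 1) ℚ.* ε) (even-inj p q)
  arc-single (m-h₂₁ i _ p)   (m-h₂₂ j _ q)    = contradiction q (odd≢even _ _ p)
  arc-single (m-h₂₂ i p _)   (m-h₁₁ j q _)    = contradiction p (odd≢even _ _ q)
  arc-single (m-h₂₂ i p _)   (m-h₁₂ j q _)    = contradiction p (odd≢even _ _ q)
  arc-single (m-h₂₂ i _ p)   (m-h₂₁ j _ q)    = contradiction p (odd≢even _ _ q)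
  arc-single (m-h₂₂ i p _)   (m-h₂₂ j q _)    = cong (λ i → toℚ (half + 2 * index i) ℚ.* ε) (even-inj p q)
  arc-single (m-m k p)       (m-m l q)        = cong (λ k → 1ℚ ℚ.- toℚ (index k ∸ 1) ℚ.* ε)
                                                  (lookup-inj mPairs-unique k l (trans (sym p) q))
  arc-single (m-a₁ i _ _)    (m-a₁ j _ _)     = refl
  arc-single (m-a₁ i p _)    (m-a₂ j q _)     = contradiction q (odd≢even _ _ p)
  arc-single (m-a₂ i p _)    (m-a₁ j q _)     = contradiction p (odd≢even _ _ q)
  arc-single (m-a₂ i _ _)    (m-a₂ j _ _)     = refl

  arc-opposite : ∀ {u v s t} → Arc u v s → Arc v u t → s ≡ t
  arc-opposite (a-a i s)  (a-a j s′)  = cong (toℚ ∘ index) (disjoint s (Step-sym {path j} s′))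
  arc-opposite (m-m k eq) (m-m l eq′) = contradiction
    (subst (uncurry _<_) (sym eq) (mPairs-ordered k))
    (<-asym (subst (uncurry _<_) (sym eq′) (mPairs-ordered l)))

  𝒢 : SimpleTemporalGraph (Vertex n)
  𝒢 = record
    { Edge      = λ u v t → Arc u v t ⊎ Arc v u t
    ; symmetric = swap
    ; loopless  = [ arc-loopless , arc-loopless ]
    ; single    = λ where
        (inj₁ p) (inj₁ q) → arc-single p q
        (inj₁ p) (inj₂ q) → arc-opposite p q
        (inj₂ p) (inj₁ q) → arc-opposite p q
        (inj₂ p) (inj₂ q) → arc-single p q
    }

  0<half : 0 < half
  0<half = n≢0⇒n>0 λ half≡0 →
    contradiction (subst (4 ≤_) (trans n≡2half (cong (2 *_) half≡0)) 4≤n) λ ()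

  one : Fin n
  one = fromℕ< (<-≤-trans z<s 4≤n)

  a₁m₁ : Edge 𝒢 (a one) (m one) ε
  a₁m₁ = inj₂ (m-a₁ (fromℕ< 0<half) one≡ one≡)
    where
    one≡ : index one ≡ 2 * index (fromℕ< 0<half) ∸ 1
    one≡ = trans (cong suc (toℕ-fromℕ< _))
                 (cong (λ k → 2 * suc k ∸ 1) (sym (toℕ-fromℕ< 0<half)))

  𝒢′ : SimpleTemporalGraph (Vertex n)
  𝒢′ = relabel 𝒢 a₁m₁ 1ℚ

{-# OPTIONS --safe #-}
-- The relabelled edge {a₁ , m₁} lets every vertex reach A by time 1.  A vertex
-- of M with odd index has its own edge to A.  One with even index ≥ 4 climbs
-- the edges inside M to mₙ and continues to m₁ and a₁; a vertex of H with
-- index ≥ 3 first joins it there, at a time below 3/8.  h₁ and h₂ meet p₁ at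
-- time 1, and m₂ goes through h₁.  All edges of p₁ have label 1, so p₁ spreads
-- to all of A, and from A everything is reached at times ≥ 1.  Hence p₁ alone
-- suffices inside A, and only linearly many edges lie outside A.
module Submission where

open import Defs
open import Data.Fin.Base as Fin using (Fin; zero; suc; toℕ; fromℕ; inject₁; combine)
open import Data.Fin using (#_)
open import Data.Fin.Induction using (<-weakInduction)
open import Data.Fin.Permutation using (_⟨$⟩ʳ_; _⟨$⟩ˡ_; inverseʳ)
open import Data.Fin.Properties
  using (toℕ<n; toℕ-fromℕ; toℕ-inject₁; toℕ-combine; combine-surjective; injective⇒≤)
  renaming (_≟_ to _≟ᶠ_)
open import Data.Fin.Relation.Unary.Top using (View; view; ‵fromℕ; ‵inject₁)
import Data.Integer.Base as ℤ
import Data.Integer.Properties as ℤ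
open import Data.List.Base
  using (List; []; _∷_; _++_; length; lookup; map; concat; tabulate; deduplicate; replicate;
         applyUpTo; applyDownFrom)
open import Data.List.Membership.Propositional using (_∈_)
open import Data.List.Membership.Propositional.Properties
  using (∈-++⁺ʳ; ∈-lookup; ∈-applyUpTo⁺; ∈-applyDownFrom⁺; ∈-tabulate⁺; ∈-concat⁺′)
open import Data.List.Properties
  using (length-deduplicate; length-map; length-++; length-tabulate;
         length-applyUpTo; length-applyDownFrom)
open import Data.List.Relation.Binary.Pointwise.Base using (Pointwise; []; _∷_)
open import Data.List.Relation.Unary.All as All using (All; []; _∷_)
import Data.List.Relation.Unary.All.Properties as All
open import Data.List.Relation.Unary.AllPairs using (AllPairs; []; _∷_)
open import Data.List.Relation.Unary.Any as Any using (Any; here; there)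
import Data.List.Relation.Unary.Any.Properties as Any
open import Data.List.Relation.Unary.Linked.Properties using (AllPairs⇒Linked)
open import Data.List.Relation.Unary.Unique.Propositional using (Unique)
import Data.List.Relation.Unary.Unique.DecSetoid.Properties as Unique
open import Data.Nat.Base as ℕ
  using (ℕ; zero; suc; _+_; _*_; _∸_; _≤_; z≤n; s≤s; z<s; s<s; NonZero)
open import Data.Nat.Coprimality using (1-coprimeTo) renaming (sym to coprime-sym)
open import Data.Nat.Divisibility using (_∣_; divides)
open import Data.Nat.ListAction using (sum)
import Data.Nat.Properties as ℕ
open import Data.Nat.Tactic.RingSolver using (solve-∀)
open import Data.Product.Base using (Σ-syntax; ∃-syntax; _×_; _,_; proj₁; proj₂)
open import Data.Rational.Base as ℚ using (ℚ; 0ℚ; 1ℚ; mkℚ)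
import Data.Rational.Properties as ℚ
open import Data.Sum.Base using (inj₁; inj₂)
open import Function.Base using (_∘_)
open import Relation.Binary.Bundles using (DecSetoid)
open import Relation.Binary.Definitions using (DecidableEquality)
open import Relation.Binary.PropositionalEquality hiding ([_])
open import Relation.Nullary.Decidable using (yes; no; map′; _×-dec_; _⊎-dec_)
open import Relation.Nullary.Negation using (¬_)

open SimpleTemporalGraph

-- Arithmetic of labels

-- `toℚ` normalises by a gcd and is stuck on a variable; with an explicit denominator 1, order and
-- arithmetic reduce to those of the integers.
toℚ≡mkℚ : ∀ k → toℚ k ≡ mkℚ (ℤ.+ k) 0 (coprime-sym (1-coprimeTo k))
toℚ≡mkℚ k = ℚ.↥p/↧p≡p (mkℚ (ℤ.+ k) 0 (coprime-sym (1-coprimeTo k)))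

toℚ-mono-≤ : ∀ {k l} → k ≤ l → toℚ k ℚ.≤ toℚ l
toℚ-mono-≤ {k} {l} k≤l = subst₂ ℚ._≤_ (sym (toℚ≡mkℚ k)) (sym (toℚ≡mkℚ l))
  (ℚ.*≤* (ℤ.*-monoʳ-≤-nonNeg (ℤ.+ 1) (ℤ.+≤+ k≤l)))

toℚ-homo-+ : ∀ k l → toℚ (k + l) ≡ toℚ k ℚ.+ toℚ l
toℚ-homo-+ k l = trans
  (cong (ℚ._/ 1) (cong₂ ℤ._+_ (sym (ℤ.*-identityʳ (ℤ.+ k))) (sym (ℤ.*-identityʳ (ℤ.+ l)))))
  (cong₂ ℚ._+_ (sym (toℚ≡mkℚ k)) (sym (toℚ≡mkℚ l)))

toℚ-homo-* : ∀ k l → toℚ (k * l) ≡ toℚ k ℚ.* toℚ l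
toℚ-homo-* k l = trans (cong (ℚ._/ 1) (ℤ.pos-* k l))
  (cong₂ ℚ._*_ (sym (toℚ≡mkℚ k)) (sym (toℚ≡mkℚ l)))

n*1/n≡1 : ∀ n .{{_ : NonZero n}} → toℚ n ℚ.* (ℤ.+ 1 ℚ./ n) ≡ 1ℚ
n*1/n≡1 (suc n) = trans
  (cong₂ ℚ._*_ (toℚ≡mkℚ (suc n)) (ℚ.↥p/↧p≡p (mkℚ (ℤ.+ 1) n (1-coprimeTo (suc n)))))
  (ℚ.*-inverseʳ (mkℚ (ℤ.+ suc n) 0 (coprime-sym (1-coprimeTo (suc n)))))

p+q≤r⇒p≤r-q : ∀ {p q r} → p ℚ.+ q ℚ.≤ r → p ℚ.≤ r ℚ.- q
p+q≤r⇒p≤r-q {p} {q} {r} p+q≤r = begin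
  p                       ≡⟨ ℚ.+-identityʳ p ⟨
  p ℚ.+ 0ℚ                ≡⟨ cong (p ℚ.+_) (ℚ.+-inverseʳ q) ⟨
  p ℚ.+ (q ℚ.- q)         ≡⟨ ℚ.+-assoc p q (ℚ.- q) ⟨
  p ℚ.+ q ℚ.- q           ≤⟨ ℚ.+-monoˡ-≤ (ℚ.- q) p+q≤r ⟩
  r ℚ.- q                 ∎
  where open ℚ.≤-Reasoning

module SmallLabels {N : ℕ} .{{_ : NonZero N}} {ε : ℚ}
                   (0<ε : 0ℚ ℚ.< ε) (ε<1/N : ε ℚ.< ℤ.+ 1 ℚ./ N) where

  instance
    ε-nonNeg : ℚ.NonNegative ε
    ε-nonNeg = ℚ.nonNegative (ℚ.<⇒≤ 0<ε)

  -- The label of the edge at position `k` in the order on the edges inside M, counted from 0.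
  ℓ : ℕ → ℚ
  ℓ k = 1ℚ ℚ.- toℚ k ℚ.* ε

  ℓ0≡1 : ℓ 0 ≡ 1ℚ
  ℓ0≡1 = cong (λ q → 1ℚ ℚ.- q) (ℚ.*-zeroˡ ε)

  ℓ-anti-≤ : ∀ {k l} → k ≤ l → ℓ l ℚ.≤ ℓ k
  ℓ-anti-≤ k≤l = ℚ.+-monoʳ-≤ 1ℚ
    (ℚ.neg-antimono-≤ (ℚ.*-monoʳ-≤-nonNeg ε (toℚ-mono-≤ k≤l)))

  ℓ≤1 : ∀ k → ℓ k ℚ.≤ 1ℚ
  ℓ≤1 k = subst (ℓ k ℚ.≤_) ℓ0≡1 (ℓ-anti-≤ {0} {k} z≤n)

  cε≤1 : ∀ {c} → c ≤ N → toℚ c ℚ.* ε ℚ.≤ 1ℚ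
  cε≤1 {c} c≤N = begin
    toℚ c ℚ.* ε                ≤⟨ ℚ.*-monoʳ-≤-nonNeg ε (toℚ-mono-≤ c≤N) ⟩
    toℚ N ℚ.* ε                ≤⟨ ℚ.*-monoˡ-≤-nonNeg (toℚ N) {{N-nonNeg}} (ℚ.<⇒≤ ε<1/N) ⟩
    toℚ N ℚ.* (ℤ.+ 1 ℚ./ N)    ≡⟨ n*1/n≡1 N ⟩
    1ℚ                         ∎
    where
    open ℚ.≤-Reasoning
    N-nonNeg : ℚ.NonNegative (toℚ N)
    N-nonNeg = ℚ.nonNegative (toℚ-mono-≤ {0} {N} z≤n)

  -- Rearranges to `(c + k) * ε ≤ 1`. A journey arriving in M at time `c * ε` can thus still take
  -- the edge at position `k`.
  cε≤ℓ : ∀ {c} k → c + k ≤ N → toℚ c ℚ.* ε ℚ.≤ ℓ k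
  cε≤ℓ {c} k c+k≤N = p+q≤r⇒p≤r-q (begin
    toℚ c ℚ.* ε ℚ.+ toℚ k ℚ.* ε   ≡⟨ ℚ.*-distribʳ-+ ε (toℚ c) (toℚ k) ⟨
    (toℚ c ℚ.+ toℚ k) ℚ.* ε       ≡⟨ cong (ℚ._* ε) (toℚ-homo-+ c k) ⟨
    toℚ (c + k) ℚ.* ε             ≤⟨ cε≤1 c+k≤N ⟩
    1ℚ                            ∎)
    where open ℚ.≤-Reasoning

  ε≤1 : 1 ≤ N → ε ℚ.≤ 1ℚ
  ε≤1 1≤N = subst (ℚ._≤ 1ℚ) (ℚ.*-identityˡ ε) (cε≤1 1≤N)

-- Journeys

module _ {V : Set} (G : SimpleTemporalGraph V) where

  -- Journey s u t v leaves u no earlier than s and arrives at v no later than t;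
  -- unlike a temporal path it may revisit vertices.
  data Journey : ℚ → V → ℚ → V → Set where
    wait : ∀ {s t v} → s ℚ.≤ t → Journey s v t v
    ride : ∀ {s r t u w v} → s ℚ.≤ r → Edge G u w r → Journey r w t v → Journey s u t v

  -- All labels are compared with `s` and with each other, not only neighbouring ones, so that both
  -- conditions pass directly to suffixes.
  SimpleFrom : ℚ → V → V → Set
  SimpleFrom s u v = Σ[ p ∈ Walk G u v ]
    Unique (vertices p) × All (s ℚ.≤_) (labels p) × AllPairs ℚ._≤_ (labels p)

module _ {V : Set} {G : SimpleTemporalGraph V} where

  earlier : ∀ {s r t u v} → s ℚ.≤ r → Journey G r u t v → Journey G s u t v
  earlier s≤r (wait r≤t)     = wait (ℚ.≤-trans s≤r r≤t)
  earlier s≤r (ride r≤l e j) = ride (ℚ.≤-trans s≤r r≤l) e j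

  infixr 5 _▸_
  _▸_ : ∀ {s r t u w v} → Journey G s u r w → Journey G r w t v → Journey G s u t v
  wait s≤r     ▸ k = earlier s≤r k
  ride s≤l e j ▸ k = ride s≤l e (j ▸ k)

  edge⇒journey : ∀ {u v t} → Edge G u v t → Journey G t u t v
  edge⇒journey e = ride ℚ.≤-refl e (wait ℚ.≤-refl)

  suffixFrom : ∀ {s u v x} ((p , _) : SimpleFrom G s u v) → x ∈ vertices p → SimpleFrom G s x v
  suffixFrom p@([] , _)    (here refl) = p
  suffixFrom p@(_ ∷ _ , _) (here refl) = p
  suffixFrom (_ ∷ p , _ ∷ uniq , _ ∷ s≤ , _ ∷ sorted) (there x∈p) =
    suffixFrom (p , uniq , s≤ , sorted) x∈p

  module _ (_≟_ : DecidableEquality V) where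

    -- Loop erasure: if `u` recurs on the simple walk obtained from the rest of the journey, only
    -- the part from that occurrence on is kept.
    journey⇒simple : ∀ {s t u v} → Journey G s u t v → SimpleFrom G s u v
    journey⇒simple (wait _) = [] , [] ∷ [] , [] , []
    journey⇒simple {u = u} (ride s≤r e j)
      with p , uniq , r≤ , sorted ← journey⇒simple j
      with s≤ ← All.map (ℚ.≤-trans s≤r) r≤
      with Any.any? (u ≟_) (vertices p)
    ... | yes u∈p = suffixFrom (p , uniq , s≤ , sorted) u∈p
    ... | no  u∉p = e ∷ p , All.¬Any⇒All¬ _ u∉p ∷ uniq , s≤r ∷ s≤ , r≤ ∷ sorted

    journey⇒path : ∀ {s t u v} → Journey G s u t v → TemporalPath G u v
    journey⇒path j with p , uniq , _ , sorted ← journey⇒simple j =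
      p , uniq , AllPairs⇒Linked sorted

-- Subgraphs with a given list of edges

module _ {V : Set} where

  samePair-refl : {e : V × V} → SamePair e e
  samePair-refl = inj₁ (refl , refl)

  samePair-sym : {e f : V × V} → SamePair e f → SamePair f e
  samePair-sym (inj₁ (refl , refl)) = inj₁ (refl , refl)
  samePair-sym (inj₂ (refl , refl)) = inj₂ (refl , refl)

  samePair-trans : {e f g : V × V} → SamePair e f → SamePair f g → SamePair e g
  samePair-trans (inj₁ (refl , refl)) fg                   = fg
  samePair-trans ef                   (inj₁ (refl , refl)) = ef
  samePair-trans (inj₂ (refl , refl)) (inj₂ (refl , refl)) = inj₁ (refl , refl)

  samePair-decSetoid : DecidableEquality V → DecSetoid _ _
  samePair-decSetoid _≟_ = record
    { Carrier          = V × V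
    ; _≈_              = SamePair
    ; isDecEquivalence = record
      { isEquivalence = record
        { refl  = samePair-refl
        ; sym   = samePair-sym
        ; trans = samePair-trans
        }
      ; _≟_ = λ (u , v) (x , y) →
          (u ≟ x ×-dec v ≟ y) ⊎-dec (u ≟ y ×-dec v ≟ x)
      }
    }

  LabelledEdge : SimpleTemporalGraph V → Set
  LabelledEdge G = Σ[ (u , v) ∈ V × V ] ∃[ t ] Edge G u v t

  -- Edges are selected as unordered pairs, and `es` may repeat a pair; the labels are those of `G`.
  spanned : (G : SimpleTemporalGraph V) → List (LabelledEdge G) → SimpleTemporalGraph V
  spanned G es = record
    { Edge      = λ u v t → Edge G u v t × Any (SamePair (u , v) ∘ proj₁) es
    ; symmetric = λ (e , e∈) → symmetric G e , Any.map (samePair-trans (inj₂ (refl , refl))) e∈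
    ; loopless  = loopless G ∘ proj₁
    ; single    = λ (e , _) (f , _) → single G e f
    }

  module _ {G : SimpleTemporalGraph V} where

    ∈⇒edge : ∀ {es u v t e} → ((u , v) , t , e) ∈ es → Edge (spanned G es) u v t
    ∈⇒edge {e = e} e∈es = e , Any.map (λ where refl → samePair-refl) e∈es

    -- Overlaps within `es` are removed by deduplication up to `SamePair`, which can only shorten
    -- the list.
    spanned-edgeCount : DecidableEquality V → ∀ es →
                        ∃[ e ] EdgeCount (spanned G es) e × e ≤ length es
    spanned-edgeCount _≟_ es = length distinctPairs , record
      { edges    = distinctPairs
      ; sound    = All.deduplicate⁺ _≟′_ (All.map⁺ (All.tabulate λ {(_ , t , _)} e∈ → t , ∈⇒edge e∈))
      ; complete = λ (_ , e∈) →
          Any.deduplicate⁺ _≟′_ (λ f~g e~g → samePair-trans e~g (samePair-sym f~g)) (Any.map⁺ e∈)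
      ; distinct = Unique.deduplicate-! (samePair-decSetoid _≟_) pairs
      ; count    = refl
      } , ℕ.≤-trans (length-deduplicate _≟′_ pairs) (ℕ.≤-reflexive (length-map proj₁ es))
      where
      open DecSetoid (samePair-decSetoid _≟_) renaming (_≟_ to _≟′_) using ()
      pairs distinctPairs : List (V × V)
      pairs = map proj₁ es
      distinctPairs = deduplicate _≟′_ pairs

    -- Pigeonhole: edges with the same position in `edges` match the same pair, hence each other, so
    -- `position` is injective.
    k-edges⇒k≤e : ∀ {k e} → EdgeCount G e →
                  (f : Fin k → LabelledEdge G) →
                  (∀ {i j} → SamePair (proj₁ (f i)) (proj₁ (f j)) → i ≡ j) →
                  k ≤ e
    k-edges⇒k≤e {k} ec f f-inj = subst (k ≤_) count (injective⇒≤ {f = position} position-inj)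
      where
      open EdgeCount ec
      edge∈ : ∀ i → Any (SamePair (proj₁ (f i))) edges
      edge∈ i = complete (proj₂ (proj₂ (f i)))

      position : Fin k → Fin (length edges)
      position = Any.index ∘ edge∈

      position-inj : ∀ {i j} → position i ≡ position j → i ≡ j
      position-inj {i} {j} eq = f-inj (samePair-trans (Any.lookup-index (edge∈ i))
        (samePair-sym (subst (λ k → SamePair (proj₁ (f j)) (lookup edges k)) (sym eq)
                             (Any.lookup-index (edge∈ j)))))

-- Positions in lists and lengths of lists

-- Turns the block structure of `mPairs` into a comparison of positions, and thereby of labels.
before : ∀ {A : Set} {xs ys : List A} {x y} → x ∈ xs → y ∈ ys →
         ∃[ k ] ∃[ l ] k Fin.< l × x ≡ lookup (xs ++ ys) k × y ≡ lookup (xs ++ ys) l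
before {xs = _ ∷ xs} (here refl) y∈ys =
  zero , suc (Any.index (∈-++⁺ʳ xs y∈ys)) , z<s , refl , Any.lookup-index (∈-++⁺ʳ xs y∈ys)
before (there x∈xs) y∈ys with k , l , k<l , x≡ , y≡ ← before x∈xs y∈ys =
  suc k , suc l , s<s k<l , x≡ , y≡

length-mPairs : ∀ n q → length (mPairs n q) ≡ (q ∸ 2) + suc (q ∸ 2)
length-mPairs n q = trans (length-++ (applyUpTo _ (q ∸ 2)))
  (cong₂ (λ i j → i + suc j) (length-applyUpTo _ (q ∸ 2)) (length-applyDownFrom _ (q ∸ 2)))

length-concat : ∀ {A : Set} {xss : List (List A)} {ks} →
                Pointwise (λ xs k → length xs ≡ k) xss ks → length (concat xss) ≡ sum ks
length-concat []                          = refl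
length-concat {xss = xs ∷ _} (eq ∷ eqs) =
  trans (length-++ xs) (cong₂ _+_ eq (length-concat eqs))

-- Decidable equality of vertices

a-injective : ∀ {n} {x y : Fin n} → a x ≡ a y → x ≡ y
a-injective refl = refl

h-injective : ∀ {n} {x y : Fin n} → h x ≡ h y → x ≡ y
h-injective refl = refl

m-injective : ∀ {n} {x y : Fin n} → m x ≡ m y → x ≡ y
m-injective refl = refl

_≟ⱽ_ : ∀ {n} → DecidableEquality (Vertex n)
a x ≟ⱽ a y = map′ (cong a) a-injective (x ≟ᶠ y)
a x ≟ⱽ h y = no λ ()
a x ≟ⱽ m y = no λ ()
h x ≟ⱽ a y = no λ ()
h x ≟ⱽ h y = map′ (cong h) h-injective (x ≟ᶠ y)
h x ≟ⱽ m y = no λ ()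
m x ≟ⱽ a y = no λ ()
m x ≟ⱽ h y = no λ ()
m x ≟ⱽ m y = map′ (cong m) m-injective (x ≟ᶠ y)

-- The certificate

module Certificate (r : ℕ) {4≤n : 4 ≤ (2 + r) * 2}
                   (choices : Choices ((2 + r) * 2) (divides (2 + r) refl) 4≤n) where

  open Choices choices
  open Construction choices
  open SmallLabels {4 * ((2 + r) * 2)} 0<ε ε<1/4n

  -- Indices split by parity

  n : ℕ
  n = (2 + r) * 2

  -- As `n` is literally `half * 2`, `combine` identifies an index with a path number and a parity
  -- bit.
  odd even : Fin half → Fin n
  odd  i = combine {2 + r} {2} i zero
  even i = combine {2 + r} {2} i (suc zero)

  index-odd : ∀ i → index (odd i) ≡ 2 * index i ∸ 1
  index-odd i = trans (cong suc (trans (toℕ-combine {2 + r} {2} i zero) (ℕ.+-identityʳ _)))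
    (sym (ℕ.+-suc (toℕ i) _))

  index-even : ∀ i → index (even i) ≡ 2 * index i
  index-even i = trans (cong suc (toℕ-combine {2 + r} {2} i (suc zero))) (solve-eq (toℕ i))
    where
    solve-eq : ∀ k → suc (2 * k + 1) ≡ 2 * suc k
    solve-eq = solve-∀

  data Parity : Fin n → Set where
    isOdd  : ∀ i → Parity (odd i)
    isEven : ∀ i → Parity (even i)

  parity : ∀ x → Parity x
  parity x with combine-surjective {2 + r} {2} x
  ... | i , zero     , refl = isOdd i
  ... | i , suc zero , refl = isEven i

  last : Fin n
  last = even (fromℕ (suc r))

  index-last : index last ≡ n
  index-last = trans (index-even (fromℕ (suc r)))
    (trans (cong (λ k → 2 * suc k) (toℕ-fromℕ (suc r))) (ℕ.*-comm 2 (2 + r)))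

  -- Edges of the certificate

  𝓔 : Set
  𝓔 = LabelledEdge 𝒢′

  p : Fin n → Fin n
  p = path zero ⟨$⟩ʳ_

  -- `3 + r * 2` is `n - 1`. The absurd cases, here and for the other unchanged edges, tell the edge
  -- apart from {a₁ , m₁}, so it keeps its label from `𝒢`.
  pathEdge : Fin (3 + r * 2) → 𝓔
  pathEdge j = (a (p (inject₁ j)) , a (p (suc j))) , toℚ 1 ,
    inj₂ ((λ where (inj₁ (_ , ())); (inj₂ (() , _))) ,
          inj₁ (a-a zero (inject₁ j , suc j , cong (λ k → suc (suc k)) (sym (toℕ-inject₁ j)) , samePair-refl)))

  startEdge endEdge : Fin half → 𝓔
  startEdge i = (a (path i ⟨$⟩ʳ zero) , h (odd i)) , toℚ (index i) ,
    inj₂ ((λ where (inj₁ (_ , ())); (inj₂ (() , _))) ,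
          inj₁ (a-h₁ i (zero , refl , refl) (index-odd i)))
  endEdge i = (a (path i ⟨$⟩ʳ fromℕ (3 + r * 2)) , h (even i)) , toℚ (index i) ,
    inj₂ ((λ where (inj₁ (_ , ())); (inj₂ (() , _))) ,
          inj₁ (a-h₂ i (fromℕ (3 + r * 2) , cong suc (toℕ-fromℕ (3 + r * 2)) , refl) (index-even i)))

  -- `evenOdd` and `evenEven` carry H into M early, at times `c * ε`; `oddOdd` reaches odd indices
  -- of M late. The edges {m₂ᵢ₋₁ , h₂ᵢ} are left out.
  oddOdd evenOdd evenEven : Fin half → 𝓔
  oddOdd i = (m (odd i) , h (odd i)) , toℚ (half + 2 * index i ∸ 1) ,
    inj₂ ((λ where (inj₁ (() , _)); (inj₂ (_ , ()))) ,
          inj₁ (m-h₁₁ i (index-odd i) (index-odd i)))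
  evenOdd i = (m (even i) , h (odd i)) , toℚ (half + 2 * index i ∸ 1) ℚ.* ε ,
    inj₂ ((λ where (inj₁ (() , _)); (inj₂ (_ , ()))) ,
          inj₁ (m-h₂₁ i (index-even i) (index-odd i)))
  evenEven i = (m (even i) , h (even i)) , toℚ (half + 2 * index i) ℚ.* ε ,
    inj₂ ((λ where (inj₁ (() , _)); (inj₂ (_ , ()))) ,
          inj₁ (m-h₂₂ i (index-even i) (index-even i)))

  M-edge : ∀ x y k → (index x , index y) ≡ lookup (mPairs n half) k → 𝓔
  M-edge x y k eq = (m x , m y) , ℓ (toℕ k) ,
    inj₂ ((λ where (inj₁ (() , _)); (inj₂ (_ , ()))) , inj₁ (m-m k eq))

  -- For j = 0 , … , r - 1: the rail {m₂ⱼ₊₁ , mₙ} comes before the rung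
  -- {m₂ⱼ₊₁ , m₂ⱼ₊₄} in the order of the edges inside M.
  low : Fin r → Fin half
  low j = inject₁ (inject₁ j)

  high : Fin r → Fin half
  high j = suc (inject₁ j)

  index-low : ∀ j → index (odd (low j)) ≡ 2 * suc (toℕ j) ∸ 1
  index-low j = trans (index-odd (low j))
    (cong (λ k → 2 * suc k ∸ 1) (trans (toℕ-inject₁ (inject₁ j)) (toℕ-inject₁ j)))

  index-high : ∀ j → index (even (high j)) ≡ 2 * suc (toℕ j) + 2
  index-high j = trans (index-even (high j))
    (trans (cong (λ k → 2 * suc (suc k)) (toℕ-inject₁ j)) (solve-eq (toℕ j)))
    where
    solve-eq : ∀ k → 2 * suc (suc k) ≡ 2 * suc k + 2
    solve-eq = solve-∀

  -- Labels decrease along `mPairs`, so a rung followed by its rail is a temporal path.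
  rail-before-rung : ∀ (j : Fin r) → ∃[ k ] ∃[ l ] k Fin.< l
    × (index (odd (low j)) , index last) ≡ lookup (mPairs n half) k
    × (index (odd (low j)) , index (even (high j))) ≡ lookup (mPairs n half) l
  rail-before-rung j
    rewrite index-low j | index-high j | index-last
    -- `there` passes the pair `(n ∸ 3 , n)` between the rails and the rungs.
    = before (∈-applyUpTo⁺ _ (toℕ<n j)) (there (∈-applyDownFrom⁺ _ (toℕ<n j)))

  railEdge rungEdge : Fin r → 𝓔
  railEdge j = let k , l , k<l , rail , rung = rail-before-rung j in
    M-edge (odd (low j)) last k rail
  rungEdge j = let k , l , k<l , rail , rung = rail-before-rung j in
    M-edge (odd (low j)) (even (high j)) l rung

  -- For `q = 0` the block of rails is empty, but then `n ∸ 3` is 1; otherwise the pair is the first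
  -- rail. Position 0 gives label 1.
  topPair : ∀ q → Σ[ k ∈ Fin (length (mPairs ((2 + q) * 2) (2 + q))) ]
    toℕ k ≡ 0 × (1 , (2 + q) * 2) ≡ lookup (mPairs ((2 + q) * 2) (2 + q)) k
  topPair zero    = zero , refl , refl
  topPair (suc q) = zero , refl , refl

  topEdge : 𝓔
  topEdge = let k , _ , top = topPair r in
    M-edge (odd zero) last k (trans (cong (1 ,_) index-last) top)

  -- At `zero`, `oddAnchor` is the edge whose label was raised to 1.
  oddAnchor evenAnchor : Fin half → 𝓔
  oddAnchor zero    = (m (odd zero) , a (odd zero)) , 1ℚ , inj₁ (inj₂ (refl , refl) , refl)
  oddAnchor (suc i) = (m (odd (suc i)) , a (odd (suc i))) , ε ,
    inj₂ ((λ where (inj₁ (() , _)); (inj₂ (() , _))) ,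
          inj₁ (m-a₁ (suc i) (index-odd (suc i)) (index-odd (suc i))))
  evenAnchor i = (m (even i) , a (even i)) , toℚ (n + 1) ,
    inj₂ (even≢one i , inj₁ (m-a₂ i (index-even i) (index-even i)))
    where
    even≢one : ∀ i → ¬ SamePair (m (even i) , a (even i)) (a one , m one)
    even≢one zero    = λ where (inj₁ (() , _)); (inj₂ (() , _))
    even≢one (suc i) = λ where (inj₁ (() , _)); (inj₂ (() , _))

  -- The order matters: `family (# k)` refers to a family by its position, with `topEdge` alone at
  -- position 0.
  families : List (List 𝓔)
  families = (topEdge ∷ [])
           ∷ tabulate pathEdge
           ∷ tabulate railEdge ∷ tabulate rungEdge
           ∷ tabulate startEdge ∷ tabulate endEdge
           ∷ tabulate oddOdd ∷ tabulate evenOdd ∷ tabulate evenEven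
           ∷ tabulate oddAnchor ∷ tabulate evenAnchor
           ∷ []

  H : SimpleTemporalGraph (Vertex n)
  H = spanned 𝒢′ (concat families)

  H-edge : ∀ {k} (f : Fin k → 𝓔) → tabulate f ∈ families →
           ∀ i → let (u , v) , t , _ = f i in Edge H u v t
  H-edge f f∈ i = ∈⇒edge {G = 𝒢′} {es = concat families} {e = proj₂ (proj₂ (f i))} (∈-concat⁺′ (∈-tabulate⁺ i) f∈)

  family : ∀ k → lookup families k ∈ families
  family = ∈-lookup

  H-journeys : ∀ {k} (f : Fin k → 𝓔) → tabulate f ∈ families →
               ∀ i → let (u , v) , t , _ = f i in Journey H t u t v × Journey H t v t u
  H-journeys f f∈ i = edge⇒journey (H-edge f f∈ i) , edge⇒journey (symmetric H (H-edge f f∈ i))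

  -- Reaching every vertex from A

  a⟶h₁ : ∀ i → Journey H (toℚ (index i)) (a (path i ⟨$⟩ʳ zero)) (toℚ (index i)) (h (odd i))
  a⟶h₁ i = proj₁ (H-journeys startEdge (family (# 4)) i)

  a⟶h₂ : ∀ i → Journey H (toℚ (index i)) (a (path i ⟨$⟩ʳ fromℕ (3 + r * 2))) (toℚ (index i)) (h (even i))
  a⟶h₂ i = proj₁ (H-journeys endEdge (family (# 5)) i)

  -- The journey goes back along p₁ to its start and then forward, all at time 1.
  inA : ∀ x y → Journey H 1ℚ (a x) 1ℚ (a y)
  inA x y = subst₂ (λ x y → Journey H 1ℚ (a x) 1ℚ (a y)) (inverseʳ (path zero)) (inverseʳ (path zero))
    (backward (path zero ⟨$⟩ˡ x) ▸ forward (path zero ⟨$⟩ˡ y))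
    where
    p₁ : ∀ j → Journey H 1ℚ (a (p (inject₁ j))) 1ℚ (a (p (suc j)))
             × Journey H 1ℚ (a (p (suc j))) 1ℚ (a (p (inject₁ j)))
    p₁ = H-journeys pathEdge (family (# 1))

    forward : ∀ j → Journey H 1ℚ (a (p zero)) 1ℚ (a (p j))
    forward = <-weakInduction (λ j → Journey H 1ℚ (a (p zero)) 1ℚ (a (p j)))
      (wait ℚ.≤-refl) λ j J → J ▸ proj₁ (p₁ j)

    backward : ∀ j → Journey H 1ℚ (a (p j)) 1ℚ (a (p zero))
    backward = <-weakInduction (λ j → Journey H 1ℚ (a (p j)) 1ℚ (a (p zero)))
      (wait ℚ.≤-refl) λ j J → proj₂ (p₁ j) ▸ J

  1≤index : ∀ (i : Fin half) → 1ℚ ℚ.≤ toℚ (index i)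
  1≤index i = toℚ-mono-≤ {1} {index i} (s≤s z≤n)

  A⟶H : ∀ x {y} → Parity y → ∃[ t ] Journey H 1ℚ (a x) t (h y)
  A⟶H x (isOdd i)  = _ , inA x _ ▸ earlier (1≤index i) (a⟶h₁ i)
  A⟶H x (isEven i) = _ , inA x _ ▸ earlier (1≤index i) (a⟶h₂ i)

  -- For i > 1 the edge {m₂ᵢ₋₁ , a₂ᵢ₋₁} has label `ε`, too early after time 1, so odd indices are
  -- reached through h₂ᵢ₋₁.
  A⟶M : ∀ x {y} → Parity y → ∃[ t ] Journey H 1ℚ (a x) t (m y)
  A⟶M x (isOdd i)  = _ , inA x _ ▸ earlier (1≤index i) (a⟶h₁ i)
      ▸ earlier (toℚ-mono-≤ {index i} {half + 2 * index i ∸ 1} later)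
          (proj₂ (H-journeys oddOdd (family (# 6)) i))
    where
    later : index i ≤ half + 2 * index i ∸ 1
    -- The right-hand side of the goal reduces to `suc r + 2 * index i`.
    later = ℕ.≤-trans (ℕ.m≤m+n (index i) _) (ℕ.m≤n+m (2 * index i) (suc r))
  A⟶M x (isEven i) = _ , inA x _
      ▸ earlier (toℚ-mono-≤ {1} {n + 1} (s≤s z≤n))
          (proj₂ (H-journeys evenAnchor (family (# 10)) i))

  fromA : ∀ x v → ∃[ t ] Journey H 1ℚ (a x) t v
  fromA x (a y) = _ , inA x y
  fromA x (h y) = A⟶H x (parity y)
  fromA x (m y) = A⟶M x (parity y)

  -- Reaching A by time 1

  -- The largest coefficient of `ε` between M and H is `half + n`, and fewer than `n` edges lie
  -- inside M; this is why `ε < 1/(4n)` suffices.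
  label-bound : ∀ {c} → c ≤ half + n → (k : Fin (length (mPairs n half))) → c + toℕ k ≤ 4 * n
  label-bound {c} c≤ k = begin
    c + toℕ k                          ≤⟨ ℕ.+-mono-≤ c≤ (ℕ.<⇒≤ (toℕ<n k)) ⟩
    half + n + length (mPairs n half)  ≡⟨ cong (half + n +_) (length-mPairs n half) ⟩
    half + n + (r + suc r)             ≤⟨ ℕ.m+n≤o⇒m≤o _ (ℕ.≤-reflexive (slack r)) ⟩
    4 * n                              ∎
    where
    open ℕ.≤-Reasoning
    -- `9 + 3 * r` is the exact difference, which makes the inequality a polynomial identity.
    slack : ∀ r → 2 + r + (2 + r) * 2 + (r + suc r) + (9 + 3 * r) ≡ 4 * ((2 + r) * 2)
    slack = solve-∀

  -- Both edges, {m₁ , mₙ} and {a₁ , m₁}, have label exactly 1; at its old label `ε` the second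
  -- would come too early.
  viaTop : Journey H 1ℚ (m last) 1ℚ (a one)
  viaTop = edge⇒journey {G = H} (symmetric H top) ▸ proj₁ (H-journeys oddAnchor (family (# 9)) zero)
    where
    top : Edge H (m one) (m last) 1ℚ
    top = subst (Edge H (m one) (m last))
      (trans (cong ℓ (proj₁ (proj₂ (topPair r)))) ℓ0≡1)
      (∈⇒edge {G = 𝒢′} {es = concat families} {e = proj₂ (proj₂ topEdge)} (here refl))

  -- The view separates mₙ, already at the top, from the vertices that first take a rung and its
  -- rail. The bound on `c` covers every arrival from H.
  fromEven : ∀ {c} → c ≤ half + n → ∀ {i} → View i →
             Journey H (toℚ c ℚ.* ε) (m (even (suc i))) 1ℚ (a one)
  fromEven {c} c≤ ‵fromℕ =
    earlier (cε≤1 {c} (ℕ.m+n≤o⇒m≤o c (label-bound c≤ (proj₁ (topPair r))))) viaTop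
  fromEven {c} c≤ (‵inject₁ j) =
    let k , l , k<l , _ = rail-before-rung j in
      earlier (cε≤ℓ {c} (toℕ l) (label-bound c≤ l))
        (proj₂ (H-journeys rungEdge (family (# 3)) j))
    ▸ earlier (ℓ-anti-≤ {toℕ k} {toℕ l} (ℕ.<⇒≤ k<l)) (proj₁ (H-journeys railEdge (family (# 2)) j))
    ▸ earlier (ℓ≤1 (toℕ k)) viaTop

  2i≤n : ∀ (i : Fin half) → 2 * index i ≤ n
  2i≤n i = ℕ.≤-trans (ℕ.*-monoʳ-≤ 2 (toℕ<n i)) (ℕ.≤-reflexive (ℕ.*-comm 2 half))

  H⟶A : ∀ {y} → Parity y → ∃[ s ] ∃[ x ] Journey H s (h y) 1ℚ (a x)
  H⟶A (isOdd zero)    = _ , _ , proj₂ (H-journeys startEdge (family (# 4)) zero)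
  H⟶A (isEven zero)   = _ , _ , proj₂ (H-journeys endEdge (family (# 5)) zero)
  H⟶A (isOdd (suc i))  = _ , _ ,
        proj₂ (H-journeys evenOdd (family (# 7)) (suc i))
      ▸ fromEven (ℕ.≤-trans (ℕ.m∸n≤m _ 1) (ℕ.+-monoʳ-≤ half (2i≤n (suc i)))) (view i)
  H⟶A (isEven (suc i)) = _ , _ ,
        proj₂ (H-journeys evenEven (family (# 8)) (suc i))
      ▸ fromEven (ℕ.+-monoʳ-≤ half (2i≤n (suc i))) (view i)

  M⟶A : ∀ {y} → Parity y → ∃[ s ] ∃[ x ] Journey H s (m y) 1ℚ (a x)
  M⟶A (isOdd zero) = _ , _ , proj₁ (H-journeys oddAnchor (family (# 9)) zero)
  M⟶A (isOdd (suc i)) = _ , _ ,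
        proj₁ (H-journeys oddAnchor (family (# 9)) (suc i)) ▸ wait (ε≤1 (s≤s z≤n))
  -- The rungs begin at m₄, so m₂ has no edge inside M.
  M⟶A (isEven zero) = _ , _ ,
        proj₁ (H-journeys evenOdd (family (# 7)) zero)
      ▸ earlier (cε≤1 {half + 2 * 1 ∸ 1} early) (proj₂ (H-journeys startEdge (family (# 4)) zero))
    where
    early : half + 2 * 1 ∸ 1 ≤ 4 * n
    early = ℕ.≤-trans (ℕ.m∸n≤m (half + 2 * 1) 1)
      (ℕ.m+n≤o⇒m≤o _ (label-bound (ℕ.+-monoʳ-≤ half (2i≤n zero)) (proj₁ (topPair r))))
  -- The journey starts inside M, so coefficient 0 serves as the departure time.
  M⟶A (isEven (suc i)) = _ , _ , fromEven {0} z≤n (view i)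

  toA : ∀ u → ∃[ s ] ∃[ x ] Journey H s u 1ℚ (a x)
  toA (a x) = _ , x , wait ℚ.≤-refl
  toA (h y) = H⟶A (parity y)
  toA (m y) = M⟶A (parity y)

  H-connected : TemporallyConnected H
  H-connected u v =
    let s , x , u→x = toA u
        t , x→v     = fromA x v
    in journey⇒path _≟ⱽ_ (u→x ▸ x→v)

  -- Counting the edges of the certificate

  length-concat-families : length (concat families) ≤ 6 * n
  length-concat-families = ℕ.m+n≤o⇒m≤o _ (ℕ.≤-reflexive (trans (cong (_+ (6 + r)) sizes) (slack r)))
    where
    sizes : length (concat families) ≡
            sum (1 ∷ 3 + r * 2 ∷ r ∷ r ∷ replicate 7 half)
    sizes = length-concat {xss = families}
      ( refl
      ∷ length-tabulate pathEdge
      ∷ length-tabulate railEdge ∷ length-tabulate rungEdge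
      ∷ length-tabulate startEdge ∷ length-tabulate endEdge
      ∷ length-tabulate oddOdd ∷ length-tabulate evenOdd ∷ length-tabulate evenEven
      ∷ length-tabulate oddAnchor ∷ length-tabulate evenAnchor
      ∷ [])
    -- The families have `18 + 11 * r` edges in total, `6 + r` short of `6 * n`.
    slack : ∀ r → 1 + ((3 + r * 2) + (r + (r + ((2 + r) + ((2 + r) + ((2 + r) + ((2 + r)
                + ((2 + r) + ((2 + r) + ((2 + r) + 0)))))))))) + (6 + r) ≡ 6 * ((2 + r) * 2)
    slack = solve-∀

  anchored : ∀ {x} → Parity x → ∃[ t ] Edge H (m x) (a x) t
  anchored (isEven i)      = _ , H-edge evenAnchor (family (# 10)) i
  anchored (isOdd zero)    = _ , H-edge oddAnchor (family (# 9)) zero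
  anchored (isOdd (suc i)) = _ , H-edge oddAnchor (family (# 9)) (suc i)

  -- One edge for each index, distinct by its endpoint in M; these give the lower bound `n ≤ e`.
  anchor : Fin n → LabelledEdge H
  anchor x = (m x , a x) , anchored (parity x)

  anchor-injective : ∀ {x y} → SamePair (proj₁ (anchor x)) (proj₁ (anchor y)) → x ≡ y
  anchor-injective (inj₁ (mx≡my , _)) = m-injective mx≡my
  anchor-injective (inj₂ (() , _))

  certificate : ∃[ H ] ∃[ e ] ConnectivityCertificate 𝒢′ H × EdgeCount H e × n ≤ e × e ≤ 6 * n
  certificate =
    let e , count , e≤ = spanned-edgeCount _≟ⱽ_ (concat families) in
    H , e , (proj₁ , H-connected) , count ,
    k-edges⇒k≤e count anchor anchor-injective , ℕ.≤-trans e≤ length-concat-families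

lemmaB2 : Σ[ c₁ ∈ ℚ ] Σ[ c₂ ∈ ℚ ] 0ℚ ℚ.< c₁ × 0ℚ ℚ.< c₂ ×
    (∀ (n : ℕ) (even : 2 ∣ n) (4≤n : 4 ≤ n) (choices : Choices n even 4≤n) →
    let open Construction choices in
    ∃[ H ] ∃[ e ] ConnectivityCertificate 𝒢′ H × EdgeCount H e ×
    c₁ ℚ.* toℚ n ℚ.≤ toℚ e × toℚ e ℚ.≤ c₂ ℚ.* toℚ n)
lemmaB2 = 1ℚ , toℚ 6 , ℚ.positive⁻¹ 1ℚ , ℚ.positive⁻¹ (toℚ 6) , λ where
  -- Quotients 0 and 1 would make `n` equal to 0 or 2, against `4 ≤ n`.
  n (divides 0 refl) () choices
  n (divides 1 refl) (s≤s (s≤s ())) choices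
  n (divides (suc (suc r)) refl) 4≤n choices →
    let H , e , cert , count , n≤e , e≤6n = Certificate.certificate r choices in
    H , e , cert , count ,
    subst (ℚ._≤ toℚ e) (sym (ℚ.*-identityˡ (toℚ n))) (toℚ-mono-≤ n≤e) ,
    subst (toℚ e ℚ.≤_) (toℚ-homo-* 6 n) (toℚ-mono-≤ e≤6n)
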